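{- Let $T_1$ and $T_2$ be theories and $V=\mathrm{var}(T_1\cup T_2)$. Then: (i) $T_1\equiv_o T_2$ (ordinary equivalence) iff $\models\forall V'\big(\mathcal{T}_E[T_1]\equiv\mathcal{T}_E[T_2]\big)$; (ii) $T_1\equiv_u T_2$ (uniform equivalence) iff $\models\forall V\,\forall V'\big((T_1\equiv T_2)\wedge\mathcal{M}[T_1,T_2]\wedge\mathcal{M}[T_2,T_1]\big)$; (iii) $T_1\equiv_s T_2$ (strong equivalence) iff $\models\forall V\,\forall V'\big((V\le V')\supset(\tau[T_1]\equiv\tau[T_2])\big)$.
   Context: Formulas are built from atoms, the constants $\top,\bot$, and the primitive connectives $\neg,\wedge,\vee,\supset$; $\varphi\equiv\psi$ abbreviates $(\varphi\supset\psi)\wedge(\psi\supset\varphi)$. A theory is a finite set of formulas, identified with the conjunction of its elements (empty conjunction $=\top$); $\mathrm{var}(\cdot)$ is the set of variables occurring. A classical interpretation is a set $I$ of atoms ($p$ is true iff $p\in I$). Priming: for each atom $p$, $p'$ and $p''$ are globally new atoms; $\varphi'$ replaces every atom $p$ of $\varphi$ by $p'$ (likewise for theories); for a set $U$ of atoms, $U'=\{p'\mid p\in U\}$ and $U''=\{p''\mid p\in U\}$; $V,V',V''$ are pairwise disjoint. QBFs extend propositional formulas by quantifiers over atoms: under $I$, $\forall p\,\Psi$ is true iff both $\Psi[p/\top]$ and $\Psi[p/\bot]$ are true, $\exists p\,\Psi$ iff at least one is. $\models\Phi$ means $\Phi$ is true under every interpretation. $\exists P\,\Phi$, $\forall P\,\Phi$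 for a finite set $P$ of atoms quantify all atoms of $P$. For indexed sets $S=\{\varphi_i\}$, $R=\{\psi_i\}$ of $n$ formulas, $S\le R$ abbreviates $\bigwedge_i(\varphi_i\supset\psi_i)$ and $S<R$ abbreviates $(S\le R)\wedge\neg(R\le S)$; among $U,U',U''$ the atoms $p,p',p''$ are paired. HT: an HT-interpretation is a pair $\langle I_H,I_T\rangle$ of sets of atoms with $I_H\subseteq I_T$; worlds $H\le T$ ($\le$ reflexive). In world $w$: $\top$ true, $\bot$ false; atom $p$ true iff $p\in I_w$; $\wedge,\vee$ classical in $w$; $\neg\psi$ true iff $\psi$ is false in all $u\ge w$; $\varphi_1\supset\varphi_2$ true iff for all $u\ge w$, $\varphi_1$ is false in $u$ or $\varphi_2$ is true in $u$. It is an HT-model of a set of formulas iff all its elements are true in $H$. An equilibrium model of $T$ is a pair $\langle I,I\rangle$ that is an HT-model of $T$ such that for no $J\subset I$ (proper subset) is $\langle J,I\rangle$ an HT-model of $T$. Equivalence notions: $T_1\equiv_oT_2$ iff they have the same equilibrium models; $T_1\equiv_uT_2$ iff $T_1\cup R\equiv_oT_2\cup R$ for every set $R$ of atoms; $T_1\equiv_sT_2$ iff $T_1\cup S\equiv_oT_2\cup S$ for every theory $S$. Translation $\tau$: $\tau[\varphi]=\varphi$ if $\varphi$ is an atom, $\top$ or $\bot$; $\tau[\varphi_1\circ\varphi_2]=\tau[\varphi_1]\circ\tau[\varphi_2]$ for $\circ\in\{\wedge,\vee\}$; $\tau[\neg\psi]=\neg\psi'$; $\tau[\varphi_1\supset\varphi_2]=(\tau[\varphi_1]\supset\tau[\varphi_2])\wedge(\varphi_1'\supset\varphi_2')$.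 $\tau''[\cdot]$ is obtained from $\tau[\cdot]$ by replacing each unprimed atom $v$ by $v''$. Encodings: for a theory $T$, $\mathcal{T}_E[T]=T'\wedge\neg\exists U\big((U<U')\wedge\tau[T]\big)$, where $U=\mathrm{var}(T)$; and, for $\{i,j\}=\{1,2\}$ and $V=\mathrm{var}(T_1\cup T_2)$, $$\mathcal{M}[T_i,T_j]=\big((V<V')\wedge\tau[T_i]\big)\supset\exists V''\big((V\le V'')\wedge(V''<V')\wedge\tau''[T_j]\big).$$
   Formalization: In (i), both encodings T_E[T_1] and T_E[T_2] quantify over U = V = var(T_1 ∪ T_2) instead of U = var(T_i): with U = var(T_i) the claim fails for T_1 = {p ∨ ¬p}, T_2 = {⊤}, whose encodings are both valid though {p} is an equilibrium model of T_1 only. -}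

module Defs where

open import Data.Bool.Base as Bool using (Bool; true; false; if_then_else_)
import Data.Bool.ListAction as ListAction
open import Data.List.Base as List using (List; []; _∷_; _++_)
open import Data.List.Membership.Propositional using () renaming (_∈_ to _∈ˡ_)
open import Data.Nat.Base using (ℕ)
open import Data.Product.Base using (∃; _×_; _,_; proj₁)
open import Data.Vec.Base as Vec using (Vec)
open import Function.Base using (_∘_; id)
open import Function.Bundles using () renaming (_⇔_ to _iff_)
open import Level using (0ℓ)
open import Relation.Binary.Definitions using (DecidableEquality)
open import Relation.Binary.PropositionalEquality
  using (_≡_; refl; sym; trans; cong; cong₂)
open import Relation.Nullary.Decidable using (does; yes; no; map′)
open import Relation.Nullary.Negation using (contradiction) renaming (¬_ to Not)
open import Relation.Unary using (Pred; _∈_; _∪_; _⊆_; _⊂_)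

infix  8 ¬_
infixr 7 _∧_
infixr 6 _∨_
infixr 5 _⊃_
infix  4 _≡ꟴ_

data Formula (A : Set) : Set where
  atom        : A → Formula A
  ⊤ ⊥         : Formula A
  ¬_          : Formula A → Formula A
  _∧_ _∨_ _⊃_ : Formula A → Formula A → Formula A

-- A list stands for the finite set of its elements; order and multiplicity
-- never matter below.
Theory : Set → Set
Theory A = List (Formula A)

⋀ : {A : Set} → Theory A → Formula A
⋀ = List.foldr _∧_ ⊤

atoms : {A : Set} → Formula A → List A
atoms (atom p) = p ∷ []
atoms ⊤        = []
atoms ⊥        = []
atoms (¬ φ)    = atoms φ
atoms (φ ∧ ψ)  = atoms φ ++ atoms ψ
atoms (φ ∨ ψ)  = atoms φ ++ atoms ψ
atoms (φ ⊃ ψ)  = atoms φ ++ atoms ψ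

var : {A : Set} → Theory A → List A
var = List.concatMap atoms

rename : {A B : Set} → (A → B) → Formula A → Formula B
rename f (atom p) = atom (f p)
rename f ⊤        = ⊤
rename f ⊥        = ⊥
rename f (¬ φ)    = ¬ rename f φ
rename f (φ ∧ ψ)  = rename f φ ∧ rename f ψ
rename f (φ ∨ ψ)  = rename f φ ∨ rename f ψ
rename f (φ ⊃ ψ)  = rename f φ ⊃ rename f ψ

------------------------------------------------------------------------
-- Classical semantics

-- Sets of atoms are given by characteristic functions, so that every
-- formula has a classical truth value.
AtomSet : Set → Set
AtomSet A = A → Bool

El : {A : Set} → AtomSet A → Pred A 0ℓ
El I p = I p ≡ true

⟦_⟧ : {A : Set} → Formula A → AtomSet A → Bool
⟦ atom p ⟧ I = I p
⟦ ⊤ ⟧      I = true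
⟦ ⊥ ⟧      I = false
⟦ ¬ φ ⟧    I = Bool.not (⟦ φ ⟧ I)
⟦ φ ∧ ψ ⟧  I = ⟦ φ ⟧ I Bool.∧ ⟦ ψ ⟧ I
⟦ φ ∨ ψ ⟧  I = ⟦ φ ⟧ I Bool.∨ ⟦ ψ ⟧ I
⟦ φ ⊃ ψ ⟧  I = Bool.not (⟦ φ ⟧ I) Bool.∨ ⟦ ψ ⟧ I

------------------------------------------------------------------------
-- Quantified Boolean formulas

data QBF (A : Set) : Set where
  prop        : Formula A → QBF A
  ¬_          : QBF A → QBF A
  _∧_ _∨_ _⊃_ : QBF A → QBF A → QBF A
  all ex      : A → QBF A → QBF A

_≡ꟴ_ : {A : Set} → QBF A → QBF A → QBF A
Φ ≡ꟴ Ψ = (Φ ⊃ Ψ) ∧ (Ψ ⊃ Φ)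

all* ex* : {A : Set} → List A → QBF A → QBF A
all* P Φ = List.foldr all Φ P
ex*  P Φ = List.foldr ex  Φ P

module QBFSemantics {A : Set} (_≟_ : DecidableEquality A) where

  _[_↦_] : AtomSet A → A → Bool → AtomSet A
  (I [ p ↦ b ]) q = if does (q ≟ p) then b else I q

  -- Quantifiers are evaluated by updating the interpretation rather than by
  -- substituting ⊤ and ⊥; `eval-all` and `eval-ex` below show that the two
  -- descriptions agree.
  eval : QBF A → AtomSet A → Bool
  eval (prop φ)  I = ⟦ φ ⟧ I
  eval (¬ Φ)     I = Bool.not (eval Φ I)
  eval (Φ ∧ Ψ)   I = eval Φ I Bool.∧ eval Ψ I
  eval (Φ ∨ Ψ)   I = eval Φ I Bool.∨ eval Ψ I
  eval (Φ ⊃ Ψ)   I = Bool.not (eval Φ I) Bool.∨ eval Ψ I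
  eval (all p Φ) I = eval Φ (I [ p ↦ true ]) Bool.∧ eval Φ (I [ p ↦ false ])
  eval (ex p Φ)  I = eval Φ (I [ p ↦ true ]) Bool.∨ eval Φ (I [ p ↦ false ])

  Valid : QBF A → Set
  Valid Φ = ∀ I → eval Φ I ≡ true

  constant : Bool → Formula A
  constant b = if b then ⊤ else ⊥

  substᶠ : A → Bool → Formula A → Formula A
  substᶠ p b (atom q) = if does (q ≟ p) then constant b else atom q
  substᶠ p b ⊤        = ⊤
  substᶠ p b ⊥        = ⊥
  substᶠ p b (¬ φ)    = ¬ substᶠ p b φ
  substᶠ p b (φ ∧ ψ)  = substᶠ p b φ ∧ substᶠ p b ψ
  substᶠ p b (φ ∨ ψ)  = substᶠ p b φ ∨ substᶠ p b ψ
  substᶠ p b (φ ⊃ ψ)  = substᶠ p b φ ⊃ substᶠ p b ψ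

  -- Only free occurrences are replaced.
  subst : A → Bool → QBF A → QBF A
  subst p b (prop φ)  = prop (substᶠ p b φ)
  subst p b (¬ Φ)     = ¬ subst p b Φ
  subst p b (Φ ∧ Ψ)   = subst p b Φ ∧ subst p b Ψ
  subst p b (Φ ∨ Ψ)   = subst p b Φ ∨ subst p b Ψ
  subst p b (Φ ⊃ Ψ)   = subst p b Φ ⊃ subst p b Ψ
  subst p b (all q Φ) = all q (if does (q ≟ p) then Φ else subst p b Φ)
  subst p b (ex q Φ)  = ex  q (if does (q ≟ p) then Φ else subst p b Φ)

  ⟦⟧-cong : ∀ φ {I J : AtomSet A} → (∀ q → I q ≡ J q) → ⟦ φ ⟧ I ≡ ⟦ φ ⟧ J
  ⟦⟧-cong (atom p) e = e p
  ⟦⟧-cong ⊤        e = refl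
  ⟦⟧-cong ⊥        e = refl
  ⟦⟧-cong (¬ φ)    e = cong Bool.not (⟦⟧-cong φ e)
  ⟦⟧-cong (φ ∧ ψ)  e = cong₂ Bool._∧_ (⟦⟧-cong φ e) (⟦⟧-cong ψ e)
  ⟦⟧-cong (φ ∨ ψ)  e = cong₂ Bool._∨_ (⟦⟧-cong φ e) (⟦⟧-cong ψ e)
  ⟦⟧-cong (φ ⊃ ψ)  e =
    cong₂ Bool._∨_ (cong Bool.not (⟦⟧-cong φ e)) (⟦⟧-cong ψ e)

  update-cong : ∀ {I J : AtomSet A} p b → (∀ q → I q ≡ J q) →
                ∀ q → (I [ p ↦ b ]) q ≡ (J [ p ↦ b ]) q
  update-cong p b e q with q ≟ p
  ... | yes _ = refl
  ... | no  _ = e q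

  eval-cong : ∀ Φ {I J : AtomSet A} → (∀ q → I q ≡ J q) → eval Φ I ≡ eval Φ J
  eval-cong (prop φ)  e = ⟦⟧-cong φ e
  eval-cong (¬ Φ)     e = cong Bool.not (eval-cong Φ e)
  eval-cong (Φ ∧ Ψ)   e = cong₂ Bool._∧_ (eval-cong Φ e) (eval-cong Ψ e)
  eval-cong (Φ ∨ Ψ)   e = cong₂ Bool._∨_ (eval-cong Φ e) (eval-cong Ψ e)
  eval-cong (Φ ⊃ Ψ)   e =
    cong₂ Bool._∨_ (cong Bool.not (eval-cong Φ e)) (eval-cong Ψ e)
  eval-cong (all p Φ) e =
    cong₂ Bool._∧_ (eval-cong Φ (update-cong p true e))
                   (eval-cong Φ (update-cong p false e))
  eval-cong (ex p Φ)  e =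
    cong₂ Bool._∨_ (eval-cong Φ (update-cong p true e))
                   (eval-cong Φ (update-cong p false e))

  update-shadow : ∀ I p b c q →
                  (I [ p ↦ c ]) q ≡ ((I [ p ↦ b ]) [ p ↦ c ]) q
  update-shadow I p b c q with q ≟ p
  ... | yes _ = refl
  ... | no  _ = refl

  update-comm : ∀ I {p r} b c → Not (r ≡ p) → ∀ q →
                ((I [ r ↦ c ]) [ p ↦ b ]) q ≡ ((I [ p ↦ b ]) [ r ↦ c ]) q
  update-comm I {p} {r} b c r≢p q with q ≟ p | q ≟ r
  ... | yes q≡p | yes q≡r = contradiction (trans (sym q≡r) q≡p) r≢p
  ... | yes _   | no _    = refl
  ... | no _    | yes _   = refl
  ... | no _    | no _    = refl

  ⟦substᶠ⟧ : ∀ p b φ I → ⟦ substᶠ p b φ ⟧ I ≡ ⟦ φ ⟧ (I [ p ↦ b ])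
  ⟦substᶠ⟧ p b (atom q) I with q ≟ p
  ⟦substᶠ⟧ p true  (atom q) I | yes _ = refl
  ⟦substᶠ⟧ p false (atom q) I | yes _ = refl
  ⟦substᶠ⟧ p b     (atom q) I | no  _ = refl
  ⟦substᶠ⟧ p b ⊤        I = refl
  ⟦substᶠ⟧ p b ⊥        I = refl
  ⟦substᶠ⟧ p b (¬ φ)    I = cong Bool.not (⟦substᶠ⟧ p b φ I)
  ⟦substᶠ⟧ p b (φ ∧ ψ)  I = cong₂ Bool._∧_ (⟦substᶠ⟧ p b φ I) (⟦substᶠ⟧ p b ψ I)
  ⟦substᶠ⟧ p b (φ ∨ ψ)  I = cong₂ Bool._∨_ (⟦substᶠ⟧ p b φ I) (⟦substᶠ⟧ p b ψ I)
  ⟦substᶠ⟧ p b (φ ⊃ ψ)  I =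
    cong₂ Bool._∨_ (cong Bool.not (⟦substᶠ⟧ p b φ I)) (⟦substᶠ⟧ p b ψ I)

  mutual
    eval-subst : ∀ p b Φ I → eval (subst p b Φ) I ≡ eval Φ (I [ p ↦ b ])
    eval-subst p b (prop φ)  I = ⟦substᶠ⟧ p b φ I
    eval-subst p b (¬ Φ)     I = cong Bool.not (eval-subst p b Φ I)
    eval-subst p b (Φ ∧ Ψ)   I =
      cong₂ Bool._∧_ (eval-subst p b Φ I) (eval-subst p b Ψ I)
    eval-subst p b (Φ ∨ Ψ)   I =
      cong₂ Bool._∨_ (eval-subst p b Φ I) (eval-subst p b Ψ I)
    eval-subst p b (Φ ⊃ Ψ)   I =
      cong₂ Bool._∨_ (cong Bool.not (eval-subst p b Φ I)) (eval-subst p b Ψ I)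
    eval-subst p b (all q Φ) I =
      cong₂ Bool._∧_ (eval-under p b q true Φ I) (eval-under p b q false Φ I)
    eval-subst p b (ex q Φ)  I =
      cong₂ Bool._∨_ (eval-under p b q true Φ I) (eval-under p b q false Φ I)

    eval-under : ∀ p b q c Φ I →
      eval (if does (q ≟ p) then Φ else subst p b Φ) (I [ q ↦ c ])
        ≡ eval Φ ((I [ p ↦ b ]) [ q ↦ c ])
    eval-under p b q c Φ I with q ≟ p
    ... | yes refl = eval-cong Φ (update-shadow I p b c)
    ... | no  q≢p  = trans (eval-subst p b Φ (I [ q ↦ c ]))
                           (eval-cong Φ (update-comm I b c q≢p))

  eval-all : ∀ p Φ I →
    eval (all p Φ) I ≡ eval (subst p true Φ) I Bool.∧ eval (subst p false Φ) I
  eval-all p Φ I =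
    sym (cong₂ Bool._∧_ (eval-subst p true Φ I) (eval-subst p false Φ I))

  eval-ex : ∀ p Φ I →
    eval (ex p Φ) I ≡ eval (subst p true Φ) I Bool.∨ eval (subst p false Φ) I
  eval-ex p Φ I =
    sym (cong₂ Bool._∨_ (eval-subst p true Φ I) (eval-subst p false Φ I))

------------------------------------------------------------------------
-- Here-and-there logic and equilibrium models

record HTInterpretation (A : Set) : Set where
  constructor ⟨_,_∣_⟩
  field
    I-H I-T : AtomSet A
    H⊆T     : El I-H ⊆ El I-T

open HTInterpretation public

data World : Set where
  here there : World

-- The worlds u with w ≤ u.
above : World → List World
above here  = here ∷ there ∷ []
above there = there ∷ []

I-at : {A : Set} → HTInterpretation A → World → AtomSet A
I-at M here  = I-H M
I-at M there = I-T M

truth : {A : Set} → HTInterpretation A → World → Formula A → Bool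
truth M w (atom p) = I-at M w p
truth M w ⊤        = true
truth M w ⊥        = false
truth M w (¬ φ)    = ListAction.all (λ u → Bool.not (truth M u φ)) (above w)
truth M w (φ ∧ ψ)  = truth M w φ Bool.∧ truth M w ψ
truth M w (φ ∨ ψ)  = truth M w φ Bool.∨ truth M w ψ
truth M w (φ ⊃ ψ)  =
  ListAction.all (λ u → Bool.not (truth M u φ) Bool.∨ truth M u ψ) (above w)

-- Sets of formulas are arbitrary predicates here: in uniform equivalence the
-- added set of atoms need not be finite.
FormulaSet : Set → Set₁
FormulaSet A = Pred (Formula A) 0ℓ

theory : {A : Set} → Theory A → FormulaSet A
theory T φ = φ ∈ˡ T

facts : {A : Set} → AtomSet A → FormulaSet A
facts R φ = ∃ λ p → p ∈ El R × φ ≡ atom p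

IsHTModel : {A : Set} → FormulaSet A → HTInterpretation A → Set
IsHTModel Γ M = ∀ φ → φ ∈ Γ → truth M here φ ≡ true

-- I stands for the pair ⟨ I , I ⟩.
IsEquilibriumModel : {A : Set} → FormulaSet A → AtomSet A → Set
IsEquilibriumModel Γ I =
  IsHTModel Γ ⟨ I , I ∣ id ⟩ ×
  (∀ J → (J⊂I : El J ⊂ El I) → Not (IsHTModel Γ ⟨ J , I ∣ proj₁ J⊂I ⟩))

SameEquilibria : {A : Set} → FormulaSet A → FormulaSet A → Set
SameEquilibria Γ Δ = ∀ I → IsEquilibriumModel Γ I iff IsEquilibriumModel Δ I

infix 4 _≡ₒ_ _≡ᵤ_ _≡ₛ_

_≡ₒ_ _≡ᵤ_ _≡ₛ_ : {A : Set} → Theory A → Theory A → Set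
T₁ ≡ₒ T₂ = SameEquilibria (theory T₁) (theory T₂)
T₁ ≡ᵤ T₂ = ∀ R → SameEquilibria (theory T₁ ∪ facts R) (theory T₂ ∪ facts R)
T₁ ≡ₛ T₂ = ∀ S → SameEquilibria (theory T₁ ∪ theory S) (theory T₂ ∪ theory S)

------------------------------------------------------------------------
-- Priming and the encodings

-- p ⁰ is the atom p itself, seen in the alphabet enlarged by p′ and p″.
data Primed (A : Set) : Set where
  _⁰ _′ _″ : A → Primed A

primed-≟ : {A : Set} → DecidableEquality A → DecidableEquality (Primed A)
primed-≟ _≟_ (p ⁰) (q ⁰) = map′ (cong _⁰) (λ { refl → refl }) (p ≟ q)
primed-≟ _≟_ (p ⁰) (q ′) = no λ ()
primed-≟ _≟_ (p ⁰) (q ″) = no λ ()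
primed-≟ _≟_ (p ′) (q ⁰) = no λ ()
primed-≟ _≟_ (p ′) (q ′) = map′ (cong _′) (λ { refl → refl }) (p ≟ q)
primed-≟ _≟_ (p ′) (q ″) = no λ ()
primed-≟ _≟_ (p ″) (q ⁰) = no λ ()
primed-≟ _≟_ (p ″) (q ′) = no λ ()
primed-≟ _≟_ (p ″) (q ″) = map′ (cong _″) (λ { refl → refl }) (p ≟ q)

infix 4 _⊨_

_⊨_ : {A : Set} → DecidableEquality A → QBF (Primed A) → Set
_≟_ ⊨ Φ = QBFSemantics.Valid (primed-≟ _≟_) Φ

τ : {A : Set} → Formula A → Formula (Primed A)
τ (atom p) = atom (p ⁰)
τ ⊤        = ⊤
τ ⊥        = ⊥
τ (¬ φ)    = ¬ rename _′ φ
τ (φ ∧ ψ)  = τ φ ∧ τ ψ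
τ (φ ∨ ψ)  = τ φ ∨ τ ψ
τ (φ ⊃ ψ)  = (τ φ ⊃ τ ψ) ∧ (rename _′ φ ⊃ rename _′ ψ)

τ″ : {A : Set} → Formula A → Formula (Primed A)
τ″ = rename (λ { (p ⁰) → p ″ ; (p ′) → p ′ ; (p ″) → p ″ }) ∘ τ

infix 4 _≤_ _<_

_≤_ _<_ : {A : Set} {n : ℕ} → Vec (Formula A) n → Vec (Formula A) n → Formula A
S ≤ R = ⋀ (Vec.toList (Vec.zipWith _⊃_ S R))
S < R = (S ≤ R) ∧ ¬ (R ≤ S)

-- The atoms of P decorated by f, as a family indexed by the positions of P.
family : {A : Set} → (A → Primed A) → (P : List A) →
         Vec (Formula (Primed A)) (List.length P)
family f P = Vec.map (atom ∘ f) (Vec.fromList P)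

-- U must contain the atoms of every theory being compared. With U = var T
-- taken separately for each theory, p ∨ ¬ p (equilibrium models ∅ and {p})
-- and ⊤ (equilibrium model ∅ only) would both get a valid encoding, since the
-- encoding of ⊤ would then leave p′ unconstrained.
𝒯ᴱ : {A : Set} → List A → Theory A → QBF (Primed A)
𝒯ᴱ U T =
  prop (rename _′ (⋀ T)) ∧
  ¬ ex* (List.map _⁰ U) (prop ((family _⁰ U < family _′ U) ∧ τ (⋀ T)))

ℳ : {A : Set} → List A → Theory A → Theory A → QBF (Primed A)
ℳ V Tᵢ Tⱼ =
  prop ((family _⁰ V < family _′ V) ∧ τ (⋀ Tᵢ)) ⊃
  ex* (List.map _″ V)
    (prop ((family _⁰ V ≤ family _″ V) ∧ (family _″ V < family _′ V) ∧ τ″ (⋀ Tⱼ)))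

{-# OPTIONS --safe #-}
module Submission where

-- Everything rests on one correspondence: if an interpretation K of the
-- enlarged alphabet lists the world `here` on the unprimed atoms and the world
-- `there` on the primed ones, then K satisfies τ φ classically exactly when φ
-- holds in the world `here` (⟦τ⟧); persistence is what justifies translating
-- a negation by the primed formula alone. The formulas built with ≤ and <
-- express inclusion and proper inclusion of sets of atoms that agree outside V
-- (subset⇔, proper-subset⇔), so that each encoding becomes a statement about
-- HT-models. Universal prefixes are absorbed by validity
-- (valid-all*), existential ones assert that some interpretation differing
-- only on the quantified atoms exists (eval-ex*).
--
-- Ordinary equivalence: an equilibrium model of T contains only atoms of T,
-- since any other atom could be dropped from the world `here`. Among such sets
-- 𝒯ᴱ defines the equilibrium models (equilibrium⇔𝒯ᴱ).
--
-- Uniform equivalence: the formula ℳ V T₁ T₂ says that whenever ⟨ J , I ⟩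
-- with J ⊂ I is an HT-model of T₁, some X with J ⊆ X ⊂ I gives an HT-model of
-- T₂ (ℳ⇔). If this failed, adding J as facts would make I an equilibrium model
-- of T₂ and not of T₁ (uniform⇒between). Conversely, if facts R make I an
-- equilibrium model of T₁ and ⟨ J , I ⟩ refutes its minimality for T₂, then J
-- and I agree outside V, and the set X given by ℳ V T₂ T₁ refutes
-- minimality for T₁ (between⇒uniform).
--
-- Strong equivalence: it amounts to having the same HT-models. If ⟨ J , I ⟩ is
-- a model of T₁ only, one adds the atoms of J and all implications between
-- atoms of the difference of I and J. The only X with J ⊆ X ⊆ I compatible
-- with these are J and I, so that I becomes an equilibrium model of T₂ but not
-- of T₁ (strong⇒models). The total case J = I is settled beforehand by the
-- same formulas (strong⇒total).
--
-- Truth values are Booleans, so equations with `true` are stable under double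
-- negation; this is what makes the arguments by contradiction constructive.

open import Data.Bool.Base as Bool using (Bool; true; false; if_then_else_)
open import Data.Bool.Properties using (∧-identityʳ; ⇔→≡; ¬-not) renaming (_≟_ to _≟ᵇ_)
open import Data.List.Base using (List; []; _∷_; _++_; map; filter; cartesianProductWith)
open import Data.List.Membership.Propositional using () renaming (_∈_ to _∈ˡ_)
open import Data.List.Membership.Propositional.Properties
  using (∈-map⁺; ∈-map⁻; ∈-++⁺ˡ; ∈-++⁺ʳ; ∈-++⁻; ∈-filter⁺; ∈-filter⁻;
         ∈-cartesianProductWith⁺; ∈-cartesianProductWith⁻)
import Data.List.Membership.DecPropositional as DecMembership
open import Data.List.Properties using (concatMap-++)
open import Data.List.Relation.Binary.Subset.Propositional using () renaming (_⊆_ to _⊆ˡ_)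
open import Data.List.Relation.Unary.Any using (here; there)
open import Data.Product.Base using (∃; _×_; _,_; proj₁; proj₂)
open import Data.Sum.Base using (inj₁; inj₂; [_,_])
open import Function.Base using (_∘_; id; const)
open import Function.Bundles using (Equivalence; mk⇔) renaming (_⇔_ to _iff_)
open import Function.Construct.Composition using (_⇔-∘_)
open import Function.Construct.Symmetry using (⇔-sym)
open import Relation.Binary.Definitions using (DecidableEquality)
open import Relation.Binary.PropositionalEquality
  using (_≡_; refl; sym; trans; cong; cong₂; subst)
open import Relation.Nullary.Decidable using (Dec; does; yes; no; decidable-stable; _×-dec_)
open import Relation.Nullary.Negation using (contradiction) renaming (¬_ to Not)
open import Relation.Unary using (_⊆_; _⊂_; _∪_)
open import Defs

open Equivalence using (to; from)

-- Truth tables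

∧-true : ∀ {a b} → a Bool.∧ b ≡ true iff (a ≡ true × b ≡ true)
∧-true {true}  = mk⇔ (refl ,_) proj₂
∧-true {false} = mk⇔ (λ ()) proj₁

not-true : ∀ {a} → Bool.not a ≡ true iff Not (a ≡ true)
not-true {true}  = mk⇔ (λ ()) (contradiction refl)
not-true {false} = mk⇔ (λ _ ()) (λ _ → refl)

⊃-true : ∀ {a b} → Bool.not a Bool.∨ b ≡ true iff (a ≡ true → b ≡ true)
⊃-true {true}  = mk⇔ const (λ f → f refl)
⊃-true {false} = mk⇔ (λ _ ()) (λ _ → refl)

≡-true : ∀ {a b} → (Bool.not a Bool.∨ b) Bool.∧ (Bool.not b Bool.∨ a) ≡ true iff
                   (a ≡ true iff b ≡ true)
≡-true {a} {b} = mk⇔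
  (λ e → let f , g = to ∧-true e in mk⇔ (to (⊃-true {a}) f) (to (⊃-true {b}) g))
  (λ e → from ∧-true (from (⊃-true {a}) (to e) , from (⊃-true {b}) (from e)))

true-stable : ∀ {b} → Not (Not (b ≡ true)) → b ≡ true
true-stable {b} = decidable-stable (b ≟ᵇ true)

-- Locality of the classical and the here-and-there semantics

⟦rename⟧ : {A B : Set} (f : A → B) → ∀ φ K → ⟦ rename f φ ⟧ K ≡ ⟦ φ ⟧ (K ∘ f)
⟦rename⟧ f (atom p) K = refl
⟦rename⟧ f ⊤        K = refl
⟦rename⟧ f ⊥        K = refl
⟦rename⟧ f (¬ φ)    K = cong Bool.not (⟦rename⟧ f φ K)
⟦rename⟧ f (φ ∧ ψ)  K = cong₂ Bool._∧_ (⟦rename⟧ f φ K) (⟦rename⟧ f ψ K)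
⟦rename⟧ f (φ ∨ ψ)  K = cong₂ Bool._∨_ (⟦rename⟧ f φ K) (⟦rename⟧ f ψ K)
⟦rename⟧ f (φ ⊃ ψ)  K =
  cong₂ (λ a b → Bool.not a Bool.∨ b) (⟦rename⟧ f φ K) (⟦rename⟧ f ψ K)

module _ {A : Set} where

  -- The two sets of atoms have the same elements among those of P.
  Agree : List A → AtomSet A → AtomSet A → Set
  Agree P I J = ∀ {p} → p ∈ˡ P → I p ≡ J p

  -- The two sets of atoms have the same elements outside P.
  AgreeOff : List A → AtomSet A → AtomSet A → Set
  AgreeOff P I J = ∀ {p} → Not (p ∈ˡ P) → I p ≡ J p

  -- All elements of I are in P.
  Within : List A → AtomSet A → Set
  Within P I = ∀ {p} → I p ≡ true → p ∈ˡ P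

  agreeˡ : ∀ {P Q I J} → Agree (P ++ Q) I J → Agree P I J
  agreeˡ e = e ∘ ∈-++⁺ˡ

  agreeʳ : ∀ P {Q I J} → Agree (P ++ Q) I J → Agree Q I J
  agreeʳ P e = e ∘ ∈-++⁺ʳ P

  ⟦⟧-local : ∀ (φ : Formula A) {I J} → Agree (atoms φ) I J → ⟦ φ ⟧ I ≡ ⟦ φ ⟧ J
  ⟦⟧-local (atom p) e = e (here refl)
  ⟦⟧-local ⊤        e = refl
  ⟦⟧-local ⊥        e = refl
  ⟦⟧-local (¬ φ)    e = cong Bool.not (⟦⟧-local φ e)
  ⟦⟧-local (φ ∧ ψ)  e =
    cong₂ Bool._∧_ (⟦⟧-local φ (agreeˡ e)) (⟦⟧-local ψ (agreeʳ (atoms φ) e))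
  ⟦⟧-local (φ ∨ ψ)  e =
    cong₂ Bool._∨_ (⟦⟧-local φ (agreeˡ e)) (⟦⟧-local ψ (agreeʳ (atoms φ) e))
  ⟦⟧-local (φ ⊃ ψ)  e =
    cong₂ (λ a b → Bool.not a Bool.∨ b)
      (⟦⟧-local φ (agreeˡ e)) (⟦⟧-local ψ (agreeʳ (atoms φ) e))

  truth-there : ∀ (M : HTInterpretation A) φ → truth M there φ ≡ ⟦ φ ⟧ (I-T M)
  truth-there M (atom p) = refl
  truth-there M ⊤        = refl
  truth-there M ⊥        = refl
  truth-there M (¬ φ)    = trans (∧-identityʳ _) (cong Bool.not (truth-there M φ))
  truth-there M (φ ∧ ψ)  = cong₂ Bool._∧_ (truth-there M φ) (truth-there M ψ)
  truth-there M (φ ∨ ψ)  = cong₂ Bool._∨_ (truth-there M φ) (truth-there M ψ)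
  truth-there M (φ ⊃ ψ)  =
    trans (∧-identityʳ _)
      (cong₂ (λ a b → Bool.not a Bool.∨ b) (truth-there M φ) (truth-there M ψ))

  persistence : ∀ (M : HTInterpretation A) φ → truth M here φ ≡ true → truth M there φ ≡ true
  persistence M (atom p) h = H⊆T M h
  persistence M ⊤        h = refl
  persistence M (¬ φ)    h = proj₂ (to (∧-true {Bool.not (truth M here φ)}) h)
  persistence M (φ ∧ ψ)  h =
    let h₁ , h₂ = to ∧-true h in from ∧-true (persistence M φ h₁ , persistence M ψ h₂)
  persistence M (φ ∨ ψ)  h with truth M here φ in eq
  ... | true  = cong (Bool._∨ truth M there ψ) (persistence M φ eq)
  ... | false = ∨-trueʳ (persistence M ψ h)
    where
    ∨-trueʳ : ∀ {a b} → b ≡ true → a Bool.∨ b ≡ true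
    ∨-trueʳ {true}  _ = refl
    ∨-trueʳ {false} e = e
  persistence M (φ ⊃ ψ)  h =
    proj₂ (to (∧-true {Bool.not (truth M here φ) Bool.∨ truth M here ψ}) h)

  truth-total : ∀ (I : AtomSet A) φ → truth ⟨ I , I ∣ id ⟩ here φ ≡ ⟦ φ ⟧ I
  truth-total I φ = trans (same φ) (truth-there total φ)
    where
    total : HTInterpretation A
    total = ⟨ I , I ∣ id ⟩

    idempotent : ∀ {h t} → h ≡ t → h Bool.∧ (t Bool.∧ true) ≡ t Bool.∧ true
    idempotent {true}  refl = refl
    idempotent {false} refl = refl

    same : ∀ φ → truth total here φ ≡ truth total there φ
    same (atom p) = refl
    same ⊤        = refl
    same ⊥        = refl
    same (¬ φ)    = idempotent (cong Bool.not (same φ))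
    same (φ ∧ ψ)  = cong₂ Bool._∧_ (same φ) (same ψ)
    same (φ ∨ ψ)  = cong₂ Bool._∨_ (same φ) (same ψ)
    same (φ ⊃ ψ)  =
      idempotent (cong₂ (λ a b → Bool.not a Bool.∨ b) (same φ) (same ψ))

  -- The crucial property of τ: reading the unprimed atoms in the world `here`
  -- and the primed ones in the world `there`, τ φ is true classically
  -- precisely when φ is true in the world `here`.
  ⟦τ⟧ : ∀ (M : HTInterpretation A) φ {K} →
        Agree (atoms φ) (K ∘ _⁰) (I-H M) → Agree (atoms φ) (K ∘ _′) (I-T M) →
        ⟦ τ φ ⟧ K ≡ truth M here φ
  ⟦τ⟧ M φ {K} = go φ
    where
    primed : ∀ φ → Agree (atoms φ) (K ∘ _′) (I-T M) → ⟦ rename _′ φ ⟧ K ≡ truth M there φ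
    primed φ t = trans (⟦rename⟧ _′ φ K) (trans (⟦⟧-local φ t) (sym (truth-there M φ)))

    -- By persistence, refuting φ in `there` suffices to refute it in `here`.
    negation : ∀ {h t} → (h ≡ true → t ≡ true) →
               Bool.not t ≡ Bool.not h Bool.∧ (Bool.not t Bool.∧ true)
    negation {false} {t} _ = sym (∧-identityʳ _)
    negation {true}  f rewrite f refl = refl

    go : ∀ φ → Agree (atoms φ) (K ∘ _⁰) (I-H M) → Agree (atoms φ) (K ∘ _′) (I-T M) →
         ⟦ τ φ ⟧ K ≡ truth M here φ
    go (atom p) h t = h (here refl)
    go ⊤        h t = refl
    go ⊥        h t = refl
    go (¬ φ)    h t = trans (cong Bool.not (primed φ t)) (negation {truth M here φ} (persistence M φ))
    go (φ ∧ ψ)  h t =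
      cong₂ Bool._∧_ (go φ (agreeˡ h) (agreeˡ t)) (go ψ (agreeʳ (atoms φ) h) (agreeʳ (atoms φ) t))
    go (φ ∨ ψ)  h t =
      cong₂ Bool._∨_ (go φ (agreeˡ h) (agreeˡ t)) (go ψ (agreeʳ (atoms φ) h) (agreeʳ (atoms φ) t))
    go (φ ⊃ ψ)  h t =
      cong₂ Bool._∧_
        (cong₂ (λ a b → Bool.not a Bool.∨ b)
          (go φ (agreeˡ h) (agreeˡ t)) (go ψ (agreeʳ (atoms φ) h) (agreeʳ (atoms φ) t)))
        (trans
          (cong₂ (λ a b → Bool.not a Bool.∨ b)
            (primed φ (agreeˡ t)) (primed ψ (agreeʳ (atoms φ) t)))
          (sym (∧-identityʳ _)))

-- HT-models of theories as models of the encodings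

  atoms-⋀ : (T : Theory A) → atoms (⋀ T) ≡ var T
  atoms-⋀ []      = refl
  atoms-⋀ (φ ∷ T) = cong (atoms φ ++_) (atoms-⋀ T)

  truth-⋀ : ∀ (T : Theory A) M → IsHTModel (theory T) M iff truth M here (⋀ T) ≡ true
  truth-⋀ []      M = mk⇔ (λ _ → refl) (λ _ φ ())
  truth-⋀ (φ ∷ T) M = mk⇔
    (λ m → from ∧-true (m φ (here refl) , to (truth-⋀ T M) (λ ψ ψ∈T → m ψ (there ψ∈T))))
    (λ e → λ { ψ (here refl)  → proj₁ (to ∧-true e)
             ; ψ (there ψ∈T) →
                 from (truth-⋀ T M) (proj₂ (to (∧-true {truth M here φ}) e)) ψ ψ∈T })

  -- If ⟨ J , I ⟩ is an HT-model of T, so is ⟨ I , I ⟩.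
  model-total : ∀ (T : Theory A) {M} →
                IsHTModel (theory T) M → IsHTModel (theory T) ⟨ I-T M , I-T M ∣ id ⟩
  model-total T {M} m φ φ∈T =
    trans (truth-total (I-T M) φ)
          (trans (sym (truth-there M φ)) (persistence M φ (m φ φ∈T)))

  agree-⋀ : ∀ {T V I J} → var T ⊆ˡ V → Agree V I J → Agree (atoms (⋀ T)) I J
  agree-⋀ {T} T⊆V e = subst (λ P → Agree P _ _) (sym (atoms-⋀ T)) (e ∘ T⊆V)

  model⇔τ : ∀ {T : Theory A} {V} → var T ⊆ˡ V → ∀ {M K} →
            Agree V (K ∘ _⁰) (I-H M) → Agree V (K ∘ _′) (I-T M) →
            IsHTModel (theory T) M iff ⟦ τ (⋀ T) ⟧ K ≡ true
  model⇔τ {T} T⊆V {M} h t = mk⇔ (trans e ∘ to (truth-⋀ T M)) (from (truth-⋀ T M) ∘ trans (sym e))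
    where e = ⟦τ⟧ M (⋀ T) (agree-⋀ {T} T⊆V h) (agree-⋀ {T} T⊆V t)

  model⇔τ″ : ∀ {T : Theory A} {V} → var T ⊆ˡ V → ∀ {M K} →
             Agree V (K ∘ _″) (I-H M) → Agree V (K ∘ _′) (I-T M) →
             IsHTModel (theory T) M iff ⟦ τ″ (⋀ T) ⟧ K ≡ true
  model⇔τ″ {T} T⊆V {M} {K} h t = mk⇔
    (λ m → trans (⟦rename⟧ _ (τ (⋀ T)) K) (to (model⇔τ T⊆V h t) m))
    (λ e → from (model⇔τ T⊆V h t) (trans (sym (⟦rename⟧ _ (τ (⋀ T)) K)) e))

  -- On total interpretations the HT-models are the classical models.
  total-model⇔ : ∀ {T : Theory A} {V} → var T ⊆ˡ V → ∀ (f : A → Primed A) {I K} → Agree V (K ∘ f) I →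
                 IsHTModel (theory T) ⟨ I , I ∣ id ⟩ iff ⟦ rename f (⋀ T) ⟧ K ≡ true
  total-model⇔ {T} T⊆V f {I} {K} e = mk⇔ (trans d ∘ to (truth-⋀ T _)) (from (truth-⋀ T _) ∘ trans (sym d))
    where d = trans (⟦rename⟧ f (⋀ T) K)
                (trans (⟦⟧-local (⋀ T) (agree-⋀ {T} T⊆V e)) (sym (truth-total I (⋀ T))))

  -- The interpretation of the enlarged alphabet given by one set of atoms for
  -- each decoration.
  join : AtomSet A → AtomSet A → AtomSet A → AtomSet (Primed A)
  join I J L (p ⁰) = I p
  join I J L (p ′) = J p
  join I J L (p ″) = L p

  -- Being an HT-model of T depends only on the atoms of T, and in particular
  -- not on the proof of the inclusion between the two worlds.
  model-local : ∀ {T : Theory A} {V} → var T ⊆ˡ V → ∀ {M N} →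
                Agree V (I-H M) (I-H N) → Agree V (I-T M) (I-T N) →
                IsHTModel (theory T) M → IsHTModel (theory T) N
  model-local {T = T} T⊆V {M} {N} h t =
    from (model⇔τ {T} T⊆V {N} {join (I-H M) (I-T M) (I-T M)} h t) ∘
    to (model⇔τ {T} T⊆V {M} (λ _ → refl) (λ _ → refl))

-- The orderings between decorated families of atoms

  family-≤⇔ : ∀ (f g : A → Primed A) V {K} →
    ⟦ family f V ≤ family g V ⟧ K ≡ true iff
    (∀ {p} → p ∈ˡ V → K (f p) ≡ true → K (g p) ≡ true)
  family-≤⇔ f g []      = mk⇔ (λ _ ()) (λ _ → refl)
  family-≤⇔ f g (q ∷ V) {K} = mk⇔
    (λ e → λ { (here refl) → to ⊃-true (proj₁ (to ∧-true e))
             ; (there p∈V) →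
                 to (family-≤⇔ f g V) (proj₂ (to (∧-true {Bool.not (K (f q)) Bool.∨ K (g q)}) e)) p∈V })
    (λ h → from ∧-true (from ⊃-true (h (here refl)) , from (family-≤⇔ f g V) (λ p∈V → h (there p∈V))))

-- Quantifier prefixes and changes of interpretations

module Splicing {A : Set} (_≟_ : DecidableEquality A) where

  open DecMembership _≟_ using (_∈?_) public

  -- I on the atoms of P, and J elsewhere.
  splice : List A → AtomSet A → AtomSet A → AtomSet A
  splice P I J p = if does (p ∈? P) then I p else J p

  splice-on : ∀ P I J → Agree P (splice P I J) I
  splice-on P I J {p} p∈P with p ∈? P
  ... | yes _   = refl
  ... | no p∉P = contradiction p∈P p∉P

  splice-off : ∀ P I J → AgreeOff P (splice P I J) J
  splice-off P I J {p} p∉P with p ∈? P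
  ... | yes p∈P = contradiction p∈P p∉P
  ... | no _    = refl

  splice-within : ∀ P I → Within P (splice P I (const false))
  splice-within P I {p} p∈I = decidable-stable (p ∈? P) λ p∉P →
    contradiction (trans (sym p∈I) (splice-off P I (const false) p∉P)) λ ()

  open QBFSemantics _≟_

  update-same : ∀ I p q → (I [ p ↦ I p ]) q ≡ I q
  update-same I p q with q ≟ p
  ... | yes refl = refl
  ... | no _     = refl

  update-at : ∀ I p b → (I [ p ↦ b ]) p ≡ b
  update-at I p b with p ≟ p
  ... | yes _  = refl
  ... | no p≢p = contradiction refl p≢p

  update-off : ∀ I {p q} b → Not (q ≡ p) → (I [ p ↦ b ]) q ≡ I q
  update-off I {p} {q} b q≢p with q ≟ p
  ... | yes q≡p = contradiction q≡p q≢p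
  ... | no _    = refl

  -- Validity already quantifies over all interpretations, so that a prefix of
  -- universal quantifiers is immaterial.
  valid-all* : ∀ P {Φ} → Valid (all* P Φ) iff Valid Φ
  valid-all* []      = mk⇔ id id
  valid-all* (p ∷ P) {Φ} = mk⇔
    (λ v → to (valid-all* P) (λ I →
       trans (sym (eval-cong (all* P Φ) (update-same I p))) (instantiate I (I p) (v I))))
    (λ v I → from ∧-true (from (valid-all* P) v _ , from (valid-all* P) v _))
    where
    instantiate : ∀ I b → eval (all* (p ∷ P) Φ) I ≡ true → eval (all* P Φ) (I [ p ↦ b ]) ≡ true
    instantiate I true  e = proj₁ (to ∧-true e)
    instantiate I false e = proj₂ (to (∧-true {eval (all* P Φ) (I [ p ↦ true ])}) e)

  eval-ex-intro : ∀ p {Φ} I b → eval Φ (I [ p ↦ b ]) ≡ true → eval (ex p Φ) I ≡ true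
  eval-ex-intro p I true  e rewrite e = refl
  eval-ex-intro p {Φ} I false e with eval Φ (I [ p ↦ true ])
  ... | true  = refl
  ... | false = e

  eval-ex-elim : ∀ p {Φ} I → eval (ex p Φ) I ≡ true → ∃ λ b → eval Φ (I [ p ↦ b ]) ≡ true
  eval-ex-elim p {Φ} I e with eval Φ (I [ p ↦ true ]) in eq
  ... | true  = true , eq
  ... | false = false , e

  eval-ex* : ∀ P {Φ I} → eval (ex* P Φ) I ≡ true iff ∃ λ J → AgreeOff P J I × eval Φ J ≡ true
  eval-ex* P {Φ} = mk⇔ (elim P) (λ (J , off , e) → intro P off e)
    where
    elim : ∀ P {I} → eval (ex* P Φ) I ≡ true → ∃ λ J → AgreeOff P J I × eval Φ J ≡ true
    elim []      {I} e = I , (λ _ → refl) , e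
    elim (p ∷ P) {I} e =
      let b , e′       = eval-ex-elim p {ex* P Φ} I e
          J , off , e″ = elim P e′
      in J , (λ q∉ → trans (off (q∉ ∘ there)) (update-off I b (q∉ ∘ here))) , e″

    intro : ∀ P {I J} → AgreeOff P J I → eval Φ J ≡ true → eval (ex* P Φ) I ≡ true
    intro []      {I} off e = trans (sym (eval-cong Φ (λ q → off λ ()))) e
    intro (p ∷ P) {I} {J} off e = eval-ex-intro p {ex* P Φ} I (J p) (intro P updated e)
      where
      updated : AgreeOff P J (I [ p ↦ J p ])
      updated {q} q∉P with q ≟ p
      ... | yes refl = refl
      ... | no q≢p   = off λ { (here q≡p) → q≢p q≡p ; (there q∈P) → q∉P q∈P }

-- Inclusions between sets of atoms

  remove-⊂ : ∀ {I p} → I p ≡ true → El (I [ p ↦ false ]) ⊂ El I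
  remove-⊂ {I} {p} p∈I = sub , λ I⊆ → false≢true (trans (sym (update-at I p false)) (I⊆ p∈I))
    where
    false≢true : Not (false ≡ true)
    false≢true ()
    sub : El (I [ p ↦ false ]) ⊆ El I
    sub {q} h with q ≟ p
    ... | no _ = h

  module _ {V : List A} where

    subset⇔ : ∀ (f g : A → Primed A) {I J K} →
      Agree V (K ∘ f) I → Agree V (K ∘ g) J → AgreeOff V I J →
      ⟦ family f V ≤ family g V ⟧ K ≡ true iff El I ⊆ El J
    subset⇔ f g {I} {J} {K} eI eJ off = mk⇔ ⇒ ⇐
      where
      ⇒ : ⟦ family f V ≤ family g V ⟧ K ≡ true → El I ⊆ El J
      ⇒ e {p} p∈I with p ∈? V
      ... | yes p∈V = trans (sym (eJ p∈V)) (to (family-≤⇔ f g V) e p∈V (trans (eI p∈V) p∈I))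
      ... | no p∉V  = trans (sym (off p∉V)) p∈I
      ⇐ : El I ⊆ El J → ⟦ family f V ≤ family g V ⟧ K ≡ true
      ⇐ I⊆J = from (family-≤⇔ f g V) λ p∈V h → trans (eJ p∈V) (I⊆J (trans (sym (eI p∈V)) h))

    proper-subset⇔ : ∀ (f g : A → Primed A) {I J K} →
      Agree V (K ∘ f) I → Agree V (K ∘ g) J → AgreeOff V I J →
      ⟦ family f V < family g V ⟧ K ≡ true iff El I ⊂ El J
    proper-subset⇔ f g {I} {J} {K} eI eJ off = mk⇔ ⇒ ⇐
      where
      ≤⇔ : ⟦ family f V ≤ family g V ⟧ K ≡ true iff El I ⊆ El J
      ≤⇔ = subset⇔ f g eI eJ off
      ≥⇔ : ⟦ family g V ≤ family f V ⟧ K ≡ true iff El J ⊆ El I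
      ≥⇔ = subset⇔ g f eJ eI (sym ∘ off)
      ⇒ : ⟦ family f V < family g V ⟧ K ≡ true → El I ⊂ El J
      ⇒ e = to ≤⇔ (proj₁ (to ∧-true e)) ,
             λ J⊆I → to (not-true {⟦ family g V ≤ family f V ⟧ K})
                        (proj₂ (to (∧-true {⟦ family f V ≤ family g V ⟧ K}) e))
                        (from ≥⇔ λ {p} → J⊆I {p})
      ⇐ : El I ⊂ El J → ⟦ family f V < family g V ⟧ K ≡ true
      ⇐ (I⊆J , J⊈I) = from ∧-true
        (from ≤⇔ I⊆J , from (not-true {⟦ family g V ≤ family f V ⟧ K}) λ e → J⊈I (to ≥⇔ e))

-- Equilibrium models

-- No HT-model ⟨ J , I ⟩ of T satisfies R ⊆ J ⊂ I.
NoneBetween : {A : Set} → Theory A → AtomSet A → AtomSet A → Set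
NoneBetween T R I =
  ∀ J (s : El J ⊂ El I) → El R ⊆ El J → Not (IsHTModel (theory T) ⟨ J , I ∣ proj₁ s ⟩)

module _ {A : Set} where

  facts-model⇔ : ∀ {R : AtomSet A} {M} → IsHTModel (facts R) M iff El R ⊆ El (I-H M)
  facts-model⇔ = mk⇔ (λ m {p} p∈R → m (atom p) (p , p∈R , refl))
                     (λ { R⊆ φ (p , p∈R , refl) → R⊆ p∈R })

  ∪-model⇔ : ∀ {Γ Δ : FormulaSet A} {M} → IsHTModel (Γ ∪ Δ) M iff (IsHTModel Γ M × IsHTModel Δ M)
  ∪-model⇔ = mk⇔ (λ m → (λ φ φ∈Γ → m φ (inj₁ φ∈Γ)) , (λ φ φ∈Δ → m φ (inj₂ φ∈Δ)))
                 (λ (m , n) φ → [ m φ , n φ ])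

  -- Adding facts R restricts the competitors J in the minimality condition to
  -- those that contain R.
  equilibrium-facts⇔ : ∀ {T : Theory A} {R I} → IsEquilibriumModel (theory T ∪ facts R) I iff
    (IsHTModel (theory T) ⟨ I , I ∣ id ⟩ × (El R ⊆ El I) × NoneBetween T R I)
  equilibrium-facts⇔ = mk⇔
    (λ (m , min) → let mT , mR = to ∪-model⇔ m in
       mT , to facts-model⇔ mR , λ J s R⊆J n → min J s (from ∪-model⇔ (n , from facts-model⇔ R⊆J)))
    (λ (mT , R⊆I , none) → from ∪-model⇔ (mT , from facts-model⇔ R⊆I) ,
       λ J s n → let nT , nR = to ∪-model⇔ n in none J s (to facts-model⇔ nR) nT)

module Characterisation {A : Set} (_≟_ : DecidableEquality A) where

  open Splicing _≟_
  open QBFSemantics _≟_ using (_[_↦_])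
  module Decorated = Splicing (primed-≟ _≟_)
  open QBFSemantics (primed-≟ _≟_) using (eval; Valid)

  -- If removing p from I in the world `here` still leaves an HT-model, then I
  -- is an equilibrium model only if p is not in I.
  dispensable : ∀ {Γ I p} → IsEquilibriumModel Γ I →
    (∀ (s : El (I [ p ↦ false ]) ⊆ El I) → IsHTModel Γ ⟨ I [ p ↦ false ] , I ∣ s ⟩) →
    Not (I p ≡ true)
  dispensable {I = I} {p} (_ , min) m p∈I =
    min (I [ p ↦ false ]) (remove-⊂ {I} p∈I) (m (proj₁ (remove-⊂ {I} p∈I)))

  remove-agree : ∀ {V : List A} {I p} → Not (p ∈ˡ V) → Agree V I (I [ p ↦ false ])
  remove-agree {I = I} p∉V q∈V = sym (update-off I false λ { refl → p∉V q∈V })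

  -- Outside the atoms of T, an equilibrium model of T and R has only atoms of R.
  supported : ∀ {T V} → var T ⊆ˡ V → ∀ {R I p} → IsEquilibriumModel (theory T ∪ facts R) I →
    Not (p ∈ˡ V) → I p ≡ true → R p ≡ true
  supported {T} {V} T⊆V {R} {I} {p} eq p∉V p∈I = true-stable λ p∉R →
    dispensable {I = I} {p} eq
      (λ s → from ∪-model⇔
        ( model-local {T = T} T⊆V (remove-agree {V} {I} p∉V) (λ _ → refl) mT
        , from facts-model⇔ λ {q} q∈R → trans (update-off I false λ { refl → p∉R q∈R }) (R⊆I q∈R)))
      p∈I
    where
    mT  = proj₁ (to (equilibrium-facts⇔ {T = T} {R} {I}) eq)
    R⊆I : El R ⊆ El I
    R⊆I = proj₁ (proj₂ (to (equilibrium-facts⇔ {T = T} {R} {I}) eq))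

  supported-var : ∀ {T V} → var T ⊆ˡ V → ∀ {I} → IsEquilibriumModel (theory T) I → Within V I
  supported-var {T} {V} T⊆V {I} eq {p} p∈I = decidable-stable (p ∈? V) λ p∉V →
    dispensable {I = I} {p} eq
      (λ s → model-local {T = T} T⊆V (remove-agree {V} {I} p∉V) (λ _ → refl) (proj₁ eq))
      p∈I

-- Ordinary equivalence

  ′∉⁰ : ∀ {V : List A} {p} → Not (p ′ ∈ˡ map _⁰ V)
  ′∉⁰ m with ∈-map⁻ _⁰ m
  ... | _ , _ , ()

  -- The unprimed part of K is irrelevant, being rebound by the quantifier.
  equilibrium⇔𝒯ᴱ : ∀ {T V} → var T ⊆ˡ V → ∀ {I K} →
    Agree V (K ∘ _′) I → Within V I →
    IsEquilibriumModel (theory T) I iff eval (𝒯ᴱ V T) K ≡ true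
  equilibrium⇔𝒯ᴱ {T} {V} T⊆V {I} {K} agree I⊆V = mk⇔ ⇒ ⇐
    where
    smaller : QBF (Primed A)
    smaller = ex* (map _⁰ V) (prop ((family _⁰ V < family _′ V) ∧ τ (⋀ T)))

    ⇒ : IsEquilibriumModel (theory T) I → eval (𝒯ᴱ V T) K ≡ true
    ⇒ (m , min) = from ∧-true
      (to (total-model⇔ {T = T} T⊆V _′ agree) m , from (not-true {eval smaller K}) refute)
      where
      refute : Not (eval smaller K ≡ true)
      refute e with to (Decorated.eval-ex* (map _⁰ V)) e
      ... | L , off , e′ = min J J⊂I
              (from (model⇔τ {T = T} T⊆V J-here L-there)
                (proj₂ (to (∧-true {⟦ family _⁰ V < family _′ V ⟧ L}) e′)))
        where
        J = splice V (L ∘ _⁰) I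
        J-here : Agree V (L ∘ _⁰) J
        J-here p∈V = sym (splice-on V (L ∘ _⁰) I p∈V)
        L-there : Agree V (L ∘ _′) I
        L-there p∈V = trans (off ′∉⁰) (agree p∈V)
        J⊂I : El J ⊂ El I
        J⊂I =
          to (proper-subset⇔ {V} _⁰ _′ {J} {I} {L} J-here L-there (splice-off V (L ∘ _⁰) I))
             (proj₁ (to ∧-true e′))

    ⇐ : eval (𝒯ᴱ V T) K ≡ true → IsEquilibriumModel (theory T) I
    ⇐ e = from (total-model⇔ {T = T} T⊆V _′ agree) (proj₁ (to ∧-true e)) , min
      where
      min : ∀ J (s : El J ⊂ El I) → Not (IsHTModel (theory T) ⟨ J , I ∣ proj₁ s ⟩)
      min J s m = to (not-true {eval smaller K}) (proj₂ (to (∧-true {⟦ rename _′ (⋀ T) ⟧ K}) e))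
        (from (Decorated.eval-ex* (map _⁰ V))
          (L , Decorated.splice-off (map _⁰ V) (join J J J) K ,
          from ∧-true (from (proper-subset⇔ {V} _⁰ _′ {J} {I} {L} J-here L-there off) s ,
                       to (model⇔τ {T = T} T⊆V J-here L-there) m)))
        where
        L = Decorated.splice (map _⁰ V) (join J J J) K
        J-here : Agree V (L ∘ _⁰) J
        J-here p∈V = Decorated.splice-on (map _⁰ V) (join J J J) K (∈-map⁺ _⁰ p∈V)
        L-there : Agree V (L ∘ _′) I
        L-there p∈V = trans (Decorated.splice-off (map _⁰ V) (join J J J) K ′∉⁰) (agree p∈V)
        off : AgreeOff V J I
        off p∉V = ⇔→≡ {z = true} (mk⇔ (proj₁ s) (λ p∈I → contradiction (I⊆V p∈I) p∉V))

  ordinary⇔ : ∀ {T₁ T₂ : Theory A} {V} → var T₁ ⊆ˡ V → var T₂ ⊆ˡ V →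
    (T₁ ≡ₒ T₂) iff (_≟_ ⊨ all* (map _′ V) (𝒯ᴱ V T₁ ≡ꟴ 𝒯ᴱ V T₂))
  ordinary⇔ {T₁} {T₂} {V} T₁⊆V T₂⊆V = ⇔-sym (Decorated.valid-all* (map _′ V)) ⇔-∘ mk⇔ ⇒ ⇐
    where
    ⇒ : T₁ ≡ₒ T₂ → Valid (𝒯ᴱ V T₁ ≡ꟴ 𝒯ᴱ V T₂)
    ⇒ same K = from (≡-true {eval (𝒯ᴱ V T₁) K})
      (equilibrium⇔𝒯ᴱ {T₂} T₂⊆V agree I⊆V ⇔-∘
       (same I ⇔-∘ ⇔-sym (equilibrium⇔𝒯ᴱ {T₁} T₁⊆V agree I⊆V)))
      where
      I = splice V (K ∘ _′) (const false)
      agree : Agree V (K ∘ _′) I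
      agree p∈V = sym (splice-on V (K ∘ _′) (const false) p∈V)
      I⊆V : Within V I
      I⊆V = splice-within V (K ∘ _′)

    ⇐ : Valid (𝒯ᴱ V T₁ ≡ꟴ 𝒯ᴱ V T₂) → T₁ ≡ₒ T₂
    ⇐ valid I = mk⇔
      (λ eq → let I⊆V = supported-var {T₁} T₁⊆V eq in
         from (equilibrium⇔𝒯ᴱ {T₂} T₂⊆V agree I⊆V)
           (to encodings (to (equilibrium⇔𝒯ᴱ {T₁} T₁⊆V agree I⊆V) eq)))
      (λ eq → let I⊆V = supported-var {T₂} T₂⊆V eq in
         from (equilibrium⇔𝒯ᴱ {T₁} T₁⊆V agree I⊆V)
           (from encodings (to (equilibrium⇔𝒯ᴱ {T₂} T₂⊆V agree I⊆V) eq)))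
      where
      K = join I I I
      agree : Agree V (K ∘ _′) I
      agree _ = refl
      encodings = to (≡-true {eval (𝒯ᴱ V T₁) K} {eval (𝒯ᴱ V T₂) K}) (valid K)

-- Uniform equivalence

  ⁰∉″ : ∀ {V : List A} {p} → Not (p ⁰ ∈ˡ map _″ V)
  ⁰∉″ m with ∈-map⁻ _″ m
  ... | _ , _ , ()

  ′∉″ : ∀ {V : List A} {p} → Not (p ′ ∈ˡ map _″ V)
  ′∉″ m with ∈-map⁻ _″ m
  ... | _ , _ , ()

  -- Existence of an HT-model of Tⱼ between J and I is expressed by denying
  -- `NoneBetween`; this suffices to make the existential formula true since
  -- its value is a Boolean.
  ℳ⇔ : ∀ {Tᵢ Tⱼ V} → var Tᵢ ⊆ˡ V → var Tⱼ ⊆ˡ V → ∀ {J I K} →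
    Agree V (K ∘ _⁰) J → Agree V (K ∘ _′) I → AgreeOff V J I →
    eval (ℳ V Tᵢ Tⱼ) K ≡ true iff
    (∀ (s : El J ⊂ El I) → IsHTModel (theory Tᵢ) ⟨ J , I ∣ proj₁ s ⟩ → Not (NoneBetween Tⱼ J I))
  ℳ⇔ {Tᵢ} {Tⱼ} {V} Tᵢ⊆V Tⱼ⊆V {J} {I} {K} agree⁰ agree′ off =
    mk⇔ ⇒ ⇐ ⇔-∘ ⊃-true {⟦ (family _⁰ V < family _′ V) ∧ τ (⋀ Tᵢ) ⟧ K}
    where
    between : Formula (Primed A)
    between = (family _⁰ V ≤ family _″ V) ∧ (family _″ V < family _′ V) ∧ τ″ (⋀ Tⱼ)

    strict⇔ : ⟦ family _⁰ V < family _′ V ⟧ K ≡ true iff El J ⊂ El I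
    strict⇔ = proper-subset⇔ {V} _⁰ _′ agree⁰ agree′ off

    ⇒ : (⟦ (family _⁰ V < family _′ V) ∧ τ (⋀ Tᵢ) ⟧ K ≡ true →
         eval (ex* (map _″ V) (prop between)) K ≡ true) →
        ∀ (s : El J ⊂ El I) → IsHTModel (theory Tᵢ) ⟨ J , I ∣ proj₁ s ⟩ → Not (NoneBetween Tⱼ J I)
    ⇒ f s m none
      with to (Decorated.eval-ex* (map _″ V))
             (f (from ∧-true (from strict⇔ s , to (model⇔τ {T = Tᵢ} Tᵢ⊆V agree⁰ agree′) m)))
    ... | L , offL , e = none X X⊂I J⊆X
             (from (model⇔τ″ {T = Tⱼ} Tⱼ⊆V L-X L-I)
               (proj₂ (to (∧-true {⟦ family _″ V < family _′ V ⟧ L}) e″)))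
      where
      e″ = proj₂ (to (∧-true {⟦ family _⁰ V ≤ family _″ V ⟧ L}) e)
      X = splice V (L ∘ _″) I
      L-J : Agree V (L ∘ _⁰) J
      L-J p∈V = trans (offL ⁰∉″) (agree⁰ p∈V)
      L-X : Agree V (L ∘ _″) X
      L-X p∈V = sym (splice-on V (L ∘ _″) I p∈V)
      L-I : Agree V (L ∘ _′) I
      L-I p∈V = trans (offL ′∉″) (agree′ p∈V)
      offX : AgreeOff V X I
      offX = splice-off V (L ∘ _″) I
      J⊆X : El J ⊆ El X
      J⊆X =
        to (subset⇔ {V} _⁰ _″ {J} {X} {L} L-J L-X (λ p∉V → trans (off p∉V) (sym (offX p∉V))))
           (proj₁ (to ∧-true e))
      X⊂I : El X ⊂ El I
      X⊂I = to (proper-subset⇔ {V} _″ _′ {X} {I} {L} L-X L-I offX) (proj₁ (to ∧-true e″))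

    ⇐ : (∀ (s : El J ⊂ El I) → IsHTModel (theory Tᵢ) ⟨ J , I ∣ proj₁ s ⟩ → Not (NoneBetween Tⱼ J I)) →
        ⟦ (family _⁰ V < family _′ V) ∧ τ (⋀ Tᵢ) ⟧ K ≡ true →
        eval (ex* (map _″ V) (prop between)) K ≡ true
    ⇐ some e = true-stable λ ¬ex →
      some s (from (model⇔τ {T = Tᵢ} Tᵢ⊆V agree⁰ agree′)
               (proj₂ (to (∧-true {⟦ family _⁰ V < family _′ V ⟧ K}) e)))
        λ X X⊂I J⊆X m → ¬ex (from (Decorated.eval-ex* (map _″ V)) (witness X X⊂I J⊆X m))
      where
      s : El J ⊂ El I
      s = to strict⇔ (proj₁ (to ∧-true e))
      witness : ∀ X (X⊂I : El X ⊂ El I) → El J ⊆ El X →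
                IsHTModel (theory Tⱼ) ⟨ X , I ∣ proj₁ X⊂I ⟩ →
                ∃ λ L → AgreeOff (map _″ V) L K × ⟦ between ⟧ L ≡ true
      witness X X⊂I J⊆X m = L , offL , from ∧-true
        ( from (subset⇔ {V} _⁰ _″ {J} {X} {L} L-J L-X (λ p∉V → trans (off p∉V) (sym (offX p∉V))))
               J⊆X
        , from ∧-true ( from (proper-subset⇔ {V} _″ _′ {X} {I} {L} L-X L-I offX) X⊂I
                      , to (model⇔τ″ {T = Tⱼ} Tⱼ⊆V L-X L-I) m ))
        where
        L = Decorated.splice (map _″ V) (join X X X) K
        offL : AgreeOff (map _″ V) L K
        offL = Decorated.splice-off (map _″ V) (join X X X) K
        L-J : Agree V (L ∘ _⁰) J
        L-J p∈V = trans (offL ⁰∉″) (agree⁰ p∈V)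
        L-X : Agree V (L ∘ _″) X
        L-X p∈V = Decorated.splice-on (map _″ V) (join X X X) K (∈-map⁺ _″ p∈V)
        L-I : Agree V (L ∘ _′) I
        L-I p∈V = trans (offL ′∉″) (agree′ p∈V)
        offX : AgreeOff V X I
        offX {p} p∉V = ⇔→≡ {z = true} (mk⇔ (proj₁ X⊂I) λ p∈I → J⊆X (trans (off p∉V) p∈I))

  uniform-sym : ∀ {T₁ T₂ : Theory A} → T₁ ≡ᵤ T₂ → T₂ ≡ᵤ T₁
  uniform-sym same R I = ⇔-sym (same R I)

  -- With I itself as the set of added facts, every total model is an
  -- equilibrium model.
  uniform⇒classical : ∀ {T₁ T₂ : Theory A} → T₁ ≡ᵤ T₂ → ∀ {I} →
    IsHTModel (theory T₁) ⟨ I , I ∣ id ⟩ → IsHTModel (theory T₂) ⟨ I , I ∣ id ⟩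
  uniform⇒classical {T₁} {T₂} same {I} m =
    proj₁ (to (equilibrium-facts⇔ {T = T₂} {I} {I}) (to (same I I)
      (from (equilibrium-facts⇔ {T = T₁} {I} {I}) (m , id , λ J s I⊆J _ → proj₂ s I⊆J))))

  -- If no HT-model of T₂ lies between J and I, then adding the facts J makes I
  -- an equilibrium model of T₂, but not of T₁ when ⟨ J , I ⟩ is a model of T₁.
  uniform⇒between : ∀ {T₁ T₂ : Theory A} → T₁ ≡ᵤ T₂ → ∀ {J I} (s : El J ⊂ El I) →
    IsHTModel (theory T₁) ⟨ J , I ∣ proj₁ s ⟩ → Not (NoneBetween T₂ J I)
  uniform⇒between {T₁} {T₂} same {J} {I} s m none = none₁ J s id m
    where
    equilibrium₂ : IsEquilibriumModel (theory T₂ ∪ facts J) I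
    equilibrium₂ = from equilibrium-facts⇔ (uniform⇒classical same (model-total T₁ m) , proj₁ s , none)
    none₁ : NoneBetween T₁ J I
    none₁ = proj₂ (proj₂ (to equilibrium-facts⇔ (from (same J I) equilibrium₂)))

  -- Minimality of I with respect to T₁ is inherited by T₂, as every model of
  -- T₂ below I lies below some model of T₁ that is still properly below I.
  between⇒uniform : ∀ {T₁ T₂ : Theory A} {V} → var T₁ ⊆ˡ V → var T₂ ⊆ˡ V →
    (∀ {I} → IsHTModel (theory T₁) ⟨ I , I ∣ id ⟩ → IsHTModel (theory T₂) ⟨ I , I ∣ id ⟩) →
    (∀ {J I} → AgreeOff V J I → (s : El J ⊂ El I) →
       IsHTModel (theory T₂) ⟨ J , I ∣ proj₁ s ⟩ → Not (NoneBetween T₁ J I)) →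
    ∀ {R I} → IsEquilibriumModel (theory T₁ ∪ facts R) I → IsEquilibriumModel (theory T₂ ∪ facts R) I
  between⇒uniform {T₁} {T₂} {V} T₁⊆V T₂⊆V classical between {R} {I} eq
    with to (equilibrium-facts⇔ {T = T₁} {R} {I}) eq
  ... | m , R⊆I , none = from equilibrium-facts⇔ (classical m , R⊆I , none₂)
    where
    none₂ : NoneBetween T₂ R I
    none₂ J s R⊆J m₂ = between off s m₂ λ X X⊂I J⊆X → none X X⊂I (λ {p} p∈R → J⊆X (R⊆J p∈R))
      where
      off : AgreeOff V J I
      off p∉V = ⇔→≡ {z = true} (mk⇔ (proj₁ s) λ p∈I → R⊆J (supported {T₁} T₁⊆V {R} {I} eq p∉V p∈I))

  uniform⇔ : ∀ {T₁ T₂ : Theory A} {V} → var T₁ ⊆ˡ V → var T₂ ⊆ˡ V →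
    (T₁ ≡ᵤ T₂) iff
    (_≟_ ⊨ all* (map _⁰ V) (all* (map _′ V)
      ((prop (rename _⁰ (⋀ T₁)) ≡ꟴ prop (rename _⁰ (⋀ T₂))) ∧ (ℳ V T₁ T₂ ∧ ℳ V T₂ T₁))))
  uniform⇔ {T₁} {T₂} {V} T₁⊆V T₂⊆V =
    ⇔-sym (Decorated.valid-all* (map _′ V) ⇔-∘ Decorated.valid-all* (map _⁰ V)) ⇔-∘ mk⇔ ⇒ ⇐
    where
    t₁ t₂ : QBF (Primed A)
    t₁ = prop (rename _⁰ (⋀ T₁))
    t₂ = prop (rename _⁰ (⋀ T₂))

    ⇒ : T₁ ≡ᵤ T₂ → Valid ((t₁ ≡ꟴ t₂) ∧ (ℳ V T₁ T₂ ∧ ℳ V T₂ T₁))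
    ⇒ same K = from ∧-true
      ( from (≡-true {eval t₁ K})
          (total-model⇔ {T = T₂} T₂⊆V _⁰ {K ∘ _⁰} (λ _ → refl) ⇔-∘
           (mk⇔ (uniform⇒classical same) (uniform⇒classical (uniform-sym {T₁} {T₂} same)) ⇔-∘
            ⇔-sym (total-model⇔ {T = T₁} T₁⊆V _⁰ {K ∘ _⁰} (λ _ → refl))))
      , from ∧-true
          ( from (ℳ⇔ {T₁} {T₂} T₁⊆V T₂⊆V {J} {K ∘ _′} agree (λ _ → refl) off)
                 (uniform⇒between same)
          , from (ℳ⇔ {T₂} {T₁} T₂⊆V T₁⊆V {J} {K ∘ _′} agree (λ _ → refl) off)
                 (uniform⇒between (uniform-sym {T₁} {T₂} same)) ))
      where
      J = splice V (K ∘ _⁰) (K ∘ _′)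
      agree : Agree V (K ∘ _⁰) J
      agree p∈V = sym (splice-on V (K ∘ _⁰) (K ∘ _′) p∈V)
      off : AgreeOff V J (K ∘ _′)
      off = splice-off V (K ∘ _⁰) (K ∘ _′)

    ⇐ : Valid ((t₁ ≡ꟴ t₂) ∧ (ℳ V T₁ T₂ ∧ ℳ V T₂ T₁)) → T₁ ≡ᵤ T₂
    ⇐ valid R I = mk⇔
      (between⇒uniform {T₁} {T₂} T₁⊆V T₂⊆V (to classical) λ {J} {I} off →
        to (ℳ⇔ {T₂} {T₁} T₂⊆V T₁⊆V {J} {I} (λ _ → refl) (λ _ → refl) off)
           (proj₂ (to (∧-true {eval (ℳ V T₁ T₂) (join J I I)}) (encoded (join J I I)))))
      (between⇒uniform {T₂} {T₁} T₂⊆V T₁⊆V (from classical) λ {J} {I} off →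
        to (ℳ⇔ {T₁} {T₂} T₁⊆V T₂⊆V {J} {I} (λ _ → refl) (λ _ → refl) off)
           (proj₁ (to ∧-true (encoded (join J I I)))))
      where
      encoded : ∀ K → eval (ℳ V T₁ T₂ ∧ ℳ V T₂ T₁) K ≡ true
      encoded K = proj₂ (to (∧-true {eval (t₁ ≡ꟴ t₂) K}) (valid K))
      classical : ∀ {I} → IsHTModel (theory T₁) ⟨ I , I ∣ id ⟩ iff IsHTModel (theory T₂) ⟨ I , I ∣ id ⟩
      classical {I} =
        ⇔-sym (total-model⇔ {T = T₂} T₂⊆V _⁰ (λ _ → refl)) ⇔-∘
        (to (≡-true {eval t₁ K} {eval t₂ K}) (proj₁ (to ∧-true (valid K))) ⇔-∘
         total-model⇔ {T = T₁} T₁⊆V _⁰ (λ _ → refl))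
        where K = join I I I

-- Strong equivalence

  -- p belongs to I but not to J.
  Gap : AtomSet A → AtomSet A → A → Set
  Gap J I p = I p ≡ true × J p ≡ false

  -- The atoms of J, together with formulas which make the atoms of I missing
  -- in J mutually equivalent. For I among V, the only sets X with
  -- J ⊆ X ⊆ I for which ⟨ X , I ⟩ is an HT-model are J and I.
  separator : List A → AtomSet A → AtomSet A → Theory A
  separator V J I =
    map atom (filter (λ p → J p ≟ᵇ true) V) ++ cartesianProductWith (λ p q → atom p ⊃ atom q) gap gap
    where gap = filter (λ p → (I p ≟ᵇ true) ×-dec (J p ≟ᵇ false)) V

  separator-model⇔ : ∀ {V J I} → Within V I → El J ⊆ El I →
    ∀ {X} {X⊆I : El X ⊆ El I} →
    IsHTModel (theory (separator V J I)) ⟨ X , I ∣ X⊆I ⟩ iff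
    (El J ⊆ El X ×
     (∀ p q → Gap J I p → Gap J I q → X p ≡ true → X q ≡ true))
  separator-model⇔ {V} {J} {I} I⊆V J⊆I {X} {X⊆I} = mk⇔
    (λ m →
      (λ {p} p∈J → m (atom p) (∈-++⁺ˡ (∈-map⁺ atom (∈-filter⁺ J? (I⊆V (J⊆I p∈J)) p∈J)))) ,
      (λ p q gp gq → to ⊃-true (proj₁ (to (∧-true {Bool.not (X p) Bool.∨ X q})
        (m (atom p ⊃ atom q)
         (∈-++⁺ʳ (map atom (filter J? V)) (∈-cartesianProductWith⁺ implies
            (∈-filter⁺ gap? (I⊆V (proj₁ gp)) gp) (∈-filter⁺ gap? (I⊆V (proj₁ gq)) gq))))))))
    (λ (J⊆X , closed) φ φ∈S →
      [ fact J⊆X φ , implication closed φ ] (∈-++⁻ (map atom (filter J? V)) φ∈S))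
    where
    J? : ∀ p → Dec (J p ≡ true)
    J? p = J p ≟ᵇ true
    gap? : ∀ p → Dec (Gap J I p)
    gap? p = (I p ≟ᵇ true) ×-dec (J p ≟ᵇ false)
    implies : A → A → Formula A
    implies p q = atom p ⊃ atom q

    fact : El J ⊆ El X → ∀ φ → φ ∈ˡ map atom (filter J? V) →
           truth ⟨ X , I ∣ X⊆I ⟩ here φ ≡ true
    fact J⊆X φ φ∈ with ∈-map⁻ atom φ∈
    ... | p , p∈ , refl = J⊆X (proj₂ (∈-filter⁻ J? {xs = V} p∈))

    implication : (∀ p q → Gap J I p → Gap J I q → X p ≡ true → X q ≡ true) →
      ∀ φ → φ ∈ˡ cartesianProductWith implies (filter gap? V) (filter gap? V) →
      truth ⟨ X , I ∣ X⊆I ⟩ here φ ≡ true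
    implication closed φ φ∈ with ∈-cartesianProductWith⁻ implies (filter gap? V) (filter gap? V) φ∈
    ... | p , q , p∈ , q∈ , refl =
      let gp = proj₂ (∈-filter⁻ gap? {xs = V} p∈)
          gq = proj₂ (∈-filter⁻ gap? {xs = V} q∈)
      in from ∧-true ( from ⊃-true (closed p q gp gq)
                     , from ∧-true (from (⊃-true {I p}) (λ _ → proj₁ gq) , refl))

  -- A total model I is an equilibrium model in the presence of the separator,
  -- unless J is properly below I and ⟨ J , I ⟩ is itself a model.
  separated-equilibrium : ∀ {T : Theory A} {V J I} → Within V I → El J ⊆ El I →
    IsHTModel (theory T) ⟨ I , I ∣ id ⟩ →
    (∀ (s : El J ⊂ El I) → Not (IsHTModel (theory T) ⟨ J , I ∣ proj₁ s ⟩)) →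
    IsEquilibriumModel (theory T ∪ theory (separator V J I)) I
  separated-equilibrium {T} {V} {J} {I} I⊆V J⊆I m none =
    from ∪-model⇔ (m , from (separator-model⇔ {V} {J} {I} I⊆V J⊆I)
                         (J⊆I , λ p q _ gq _ → proj₁ gq)) , min
    where
    min : ∀ X (s : El X ⊂ El I) →
          Not (IsHTModel (theory T ∪ theory (separator V J I)) ⟨ X , I ∣ proj₁ s ⟩)
    min X s n with to ∪-model⇔ n
    ... | nT , nS with to (separator-model⇔ {V} {J} {I} I⊆V J⊆I) nS
    ... | J⊆X , closed = none J⊂I (model-local {T = T} id X≗J (λ _ → refl) nT)
      where
      -- One atom of X in the gap between J and I forces all of I into X.
      X⊆J : El X ⊆ El J
      X⊆J {p} p∈X = true-stable λ p∉J → proj₂ s λ {q} q∈I → true-stable λ q∉X →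
        q∉X (closed p q (proj₁ s p∈X , ¬-not p∉J) (q∈I , ¬-not (q∉X ∘ J⊆X)) p∈X)
      X≗J : Agree (var T) X J
      X≗J {p} _ = ⇔→≡ {z = true} (mk⇔ (X⊆J {p}) J⊆X)
      J⊂I : El J ⊂ El I
      J⊂I = J⊆I , λ I⊆J → proj₂ s (λ p∈I → J⊆X (I⊆J p∈I))

  strong-sym : ∀ {T₁ T₂ : Theory A} → T₁ ≡ₛ T₂ → T₂ ≡ₛ T₁
  strong-sym same S I = ⇔-sym (same S I)

  strong⇒total : ∀ {T₁ T₂ : Theory A} {V} → T₁ ≡ₛ T₂ → ∀ {I} → Within V I →
    IsHTModel (theory T₁) ⟨ I , I ∣ id ⟩ → IsHTModel (theory T₂) ⟨ I , I ∣ id ⟩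
  strong⇒total {T₁} {T₂} {V} same {I} I⊆V m =
    proj₁ (to ∪-model⇔ (proj₁ (to (same (separator V I I) I)
      (separated-equilibrium {T₁} I⊆V id m λ s _ → proj₂ s id))))

  -- If ⟨ J , I ⟩ were a model of T₁ but not of T₂, then in the presence of the
  -- separator I would be an equilibrium model of T₂ but not of T₁.
  strong⇒models : ∀ {T₁ T₂ : Theory A} {V} → T₁ ≡ₛ T₂ → ∀ {I J} → Within V I →
    (J⊆I : El J ⊆ El I) →
    IsHTModel (theory T₁) ⟨ J , I ∣ J⊆I ⟩ → IsHTModel (theory T₂) ⟨ J , I ∣ J⊆I ⟩
  strong⇒models {T₁} {T₂} {V} same {I} {J} I⊆V J⊆I m φ φ∈T₂ =
    true-stable λ φ-false → absurd λ n → φ-false (n φ φ∈T₂)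
    where
    total₂ : IsHTModel (theory T₂) ⟨ I , I ∣ id ⟩
    total₂ = strong⇒total {T₁} {T₂} same I⊆V (model-total T₁ m)

    absurd : Not (Not (IsHTModel (theory T₂) ⟨ J , I ∣ J⊆I ⟩))
    absurd ¬n = proj₂ equilibrium₁ J J⊂I (from ∪-model⇔
        ( model-local {T = T₁} id (λ _ → refl) (λ _ → refl) m
        , from (separator-model⇔ {V} {J} {I} I⊆V J⊆I)
            (id , λ p q gp _ p∈J → contradiction (trans (sym p∈J) (proj₂ gp)) λ ()) ))
      where
      J⊂I : El J ⊂ El I
      J⊂I = J⊆I , λ I⊆J → ¬n
        (model-local {T = T₂} id (λ _ → ⇔→≡ {z = true} (mk⇔ I⊆J J⊆I)) (λ _ → refl) total₂)
      equilibrium₁ : IsEquilibriumModel (theory T₁ ∪ theory (separator V J I)) I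
      equilibrium₁ = from (same (separator V J I) I) (separated-equilibrium {T₂} I⊆V J⊆I total₂
        λ s n → ¬n (model-local {T = T₂} id (λ _ → refl) (λ _ → refl) n))

  same-models⇒equilibrium : ∀ {Γ₁ Γ₂ Δ : FormulaSet A} →
    (∀ M → IsHTModel Γ₁ M iff IsHTModel Γ₂ M) →
    ∀ {I} → IsEquilibriumModel (Γ₁ ∪ Δ) I → IsEquilibriumModel (Γ₂ ∪ Δ) I
  same-models⇒equilibrium same (m , min) =
    (let m₁ , mΔ = to ∪-model⇔ m in from ∪-model⇔ (to (same _) m₁ , mΔ)) ,
    λ J s n → let n₂ , nΔ = to ∪-model⇔ n in min J s (from ∪-model⇔ (from (same _) n₂ , nΔ))

  strong⇔ : ∀ {T₁ T₂ : Theory A} {V} → var T₁ ⊆ˡ V → var T₂ ⊆ˡ V →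
    (T₁ ≡ₛ T₂) iff
    (_≟_ ⊨ all* (map _⁰ V) (all* (map _′ V)
      (prop (family _⁰ V ≤ family _′ V) ⊃ (prop (τ (⋀ T₁)) ≡ꟴ prop (τ (⋀ T₂))))))
  strong⇔ {T₁} {T₂} {V} T₁⊆V T₂⊆V =
    ⇔-sym (Decorated.valid-all* (map _′ V) ⇔-∘ Decorated.valid-all* (map _⁰ V)) ⇔-∘ mk⇔ ⇒ ⇐
    where
    encoding : QBF (Primed A)
    encoding = prop (family _⁰ V ≤ family _′ V) ⊃ (prop (τ (⋀ T₁)) ≡ꟴ prop (τ (⋀ T₂)))

    ⇒ : T₁ ≡ₛ T₂ → Valid encoding
    ⇒ same K = from (⊃-true {⟦ family _⁰ V ≤ family _′ V ⟧ K}) λ e →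
      from (≡-true {⟦ τ (⋀ T₁) ⟧ K})
        (model⇔τ {T = T₂} T₂⊆V agreeJ agreeI ⇔-∘
         (mk⇔ (strong⇒models {T₁} {T₂} same I⊆V (J⊆I e))
              (strong⇒models {T₂} {T₁} (strong-sym {T₁} {T₂} same) I⊆V (J⊆I e)) ⇔-∘
          ⇔-sym (model⇔τ {T = T₁} T₁⊆V {⟨ J , I ∣ J⊆I e ⟩} agreeJ agreeI)))
      where
      I J : AtomSet A
      I = splice V (K ∘ _′) (const false)
      J = splice V (K ∘ _⁰) (const false)
      agreeI : Agree V (K ∘ _′) I
      agreeI p∈V = sym (splice-on V (K ∘ _′) (const false) p∈V)
      agreeJ : Agree V (K ∘ _⁰) J
      agreeJ p∈V = sym (splice-on V (K ∘ _⁰) (const false) p∈V)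
      off : AgreeOff V J I
      off p∉V = trans (splice-off V (K ∘ _⁰) (const false) p∉V)
                      (sym (splice-off V (K ∘ _′) (const false) p∉V))
      J⊆I : ⟦ family _⁰ V ≤ family _′ V ⟧ K ≡ true → El J ⊆ El I
      J⊆I = to (subset⇔ {V} _⁰ _′ {J} {I} {K} agreeJ agreeI off)
      I⊆V : Within V I
      I⊆V = splice-within V (K ∘ _′)

    ⇐ : Valid encoding → T₁ ≡ₛ T₂
    ⇐ valid S I = mk⇔ (same-models⇒equilibrium same) (same-models⇒equilibrium (⇔-sym ∘ same))
      where
      same : ∀ M → IsHTModel (theory T₁) M iff IsHTModel (theory T₂) M
      same M =
        ⇔-sym (model⇔τ {T = T₂} T₂⊆V {M} {K} (λ _ → refl) (λ _ → refl)) ⇔-∘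
        (to (≡-true {⟦ τ (⋀ T₁) ⟧ K} {⟦ τ (⋀ T₂) ⟧ K})
            (to (⊃-true {⟦ family _⁰ V ≤ family _′ V ⟧ K}) (valid K)
              (from (family-≤⇔ _⁰ _′ V) λ _ → H⊆T M)) ⇔-∘
         model⇔τ {T = T₁} T₁⊆V {M} {K} (λ _ → refl) (λ _ → refl))
        where K = join (I-H M) (I-T M) (I-T M)

theorem6 : {A : Set} (_≟_ : DecidableEquality A) (T₁ T₂ : Theory A) →
  let V  = var (T₁ ++ T₂)
      V⁰ = map _⁰ V
      V′ = map _′ V
      t₁ = prop (rename _⁰ (⋀ T₁))
      t₂ = prop (rename _⁰ (⋀ T₂))
  in
  ((T₁ ≡ₒ T₂) iff (_≟_ ⊨ all* V′ (𝒯ᴱ V T₁ ≡ꟴ 𝒯ᴱ V T₂))) ×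
  ((T₁ ≡ᵤ T₂) iff (_≟_ ⊨ all* V⁰ (all* V′ ((t₁ ≡ꟴ t₂) ∧ (ℳ V T₁ T₂ ∧ ℳ V T₂ T₁))))) ×
  ((T₁ ≡ₛ T₂) iff (_≟_ ⊨ all* V⁰ (all* V′ (prop (family _⁰ V ≤ family _′ V) ⊃ (prop (τ (⋀ T₁)) ≡ꟴ prop (τ (⋀ T₂)))))))
theorem6 _≟_ T₁ T₂ = ordinary⇔ T₁⊆V T₂⊆V , uniform⇔ T₁⊆V T₂⊆V , strong⇔ T₁⊆V T₂⊆V
  where
  open Characterisation _≟_
  T₁⊆V : var T₁ ⊆ˡ var (T₁ ++ T₂)
  T₁⊆V p∈ = subst (_ ∈ˡ_) (sym (concatMap-++ atoms T₁ T₂)) (∈-++⁺ˡ p∈)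
  T₂⊆V : var T₂ ⊆ˡ var (T₁ ++ T₂)
  T₂⊆V p∈ = subst (_ ∈ˡ_) (sym (concatMap-++ atoms T₁ T₂)) (∈-++⁺ʳ (var T₁) p∈)
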